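{- Let $d \ge 1$ and $t \geq 2$ be fixed integers, and let $H$ be a fixed $d$-uniform hypergraph with at least two edges such that $\operatorname{ex}_d(n, H) = o(n^{d})$ as $n \to \infty$. Then $$\operatorname{ex}_{d+1}(n, K_{H,t}) = O\left(\operatorname{ex}_d(n, H)^{1/t}\, n^{d+1-d/t} + t\, n^d\right).$$
   Context: All hypergraphs are finite. A $d$-uniform hypergraph is one all of whose edges are $d$-element subsets of the vertex set (for $d=1$ the edges are singletons). A hypergraph is $H$-free if it contains no (not necessarily induced) subhypergraph isomorphic to $H$. For a $d$-uniform hypergraph $H$, $\operatorname{ex}_d(n,H)$ denotes the maximum number of edges in an $H$-free $d$-uniform hypergraph on $n$ vertices. For a $d$-uniform hypergraph $H$ and a positive integer $t$, $K_{H,t}$ is the $(d+1)$-uniform hypergraph obtained from $H$ by adding $t$ new vertices $v_1,\dots,v_t$ and replacing every edge $e \in E(H)$ with the $t$ edges $e\cup\{v_1\},\dots,e\cup\{v_t\}$. (For example, if $H$ is the $1$-uniform hypergraph on $s$ vertices with $s$ edges, then $K_{H,t}=K_{s,t}$.) Asymptotic notation is as $n\to\infty$ with $d$, $t$, $H$ fixed; implied constants may depend on these fixed parameters. -}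

module Defs where

open import Data.Bool.Base using (if_then_else_)
open import Data.Bool.Properties using () renaming (_≟_ to _≟ᵇ_)
open import Data.Fin.Base using (Fin; zero; suc; finToFun; funToFin)
open import Data.Fin.Properties as Fin using (finToFun-funToFin)
open import Data.Fin.Subset
  using (Subset; inside; outside; ∣_∣; ⁅_⁆; ⊥; _∪_)
open import Data.Fin.Subset.Properties using (∣⁅x⁆∣≡1; x∈⁅x⁆; x∈⁅y⁆⇒x≡y)
open import Data.List.Base as List
  using (List; []; _∷_; length; map; filter; allFin; cartesianProductWith)
open import Data.List.Extrema.Nat using (max; v≤max⁺; argmax-sel)
open import Data.List.Membership.Propositional using (_∈_)
open import Data.List.Membership.Propositional.Properties
  using (∈-map⁺; ∈-map⁻; ∈-++⁺ˡ; ∈-++⁺ʳ; ∈-filter⁺; ∈-filter⁻; ∈-∃++)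
open import Data.List.Properties using (length-++)
open import Data.List.Relation.Unary.All as All using (All; []; _∷_; all?)
open import Data.List.Relation.Unary.All.Properties as All
  using (all-filter)
open import Data.List.Relation.Unary.AllPairs using ([]; _∷_)
open import Data.List.Relation.Unary.Any as Any using (here; there)
open import Data.List.Relation.Unary.Unique.Propositional using (Unique)
open import Data.List.Relation.Unary.Unique.Propositional.Properties as Unique
  using ()
open import Data.Nat.Base
open import Data.Nat.Properties
  using (_≟_; ≤-refl; ≤-trans; ≤-reflexive; n≤0⇒n≡0; +-suc; +-comm)
open import Data.Product.Base using (∃-syntax; _×_; _,_; proj₁; proj₂)
open import Data.Sum.Base using (inj₁; inj₂)
open import Data.Vec.Base as Vec using ([]; _∷_)
open import Data.Vec.Properties as Vec using (≡-dec)
open import Function.Base using (_∘_)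
open import Function.Definitions using (Injective)
open import Relation.Binary.Definitions using (DecidableEquality)
open import Relation.Binary.PropositionalEquality
open import Relation.Nullary using (¬_; Dec; yes; no; contradiction)
open import Relation.Nullary.Decidable using (map′; _×-dec_; _→-dec_; ¬?)

private
  variable
    d m n t : ℕ

-- The vertex set is Fin n.  The order in which the edges are listed carries
-- no meaning.
record Hypergraph (d n : ℕ) : Set where
  field
    edges   : List (Subset n)
    unique  : Unique edges
    uniform : All (λ e → ∣ e ∣ ≡ d) edges

open Hypergraph public

size : Hypergraph d n → ℕ
size G = length (edges G)

image : (Fin m → Fin n) → Subset m → Subset n
image f []      = ⊥
image f (b ∷ e) = (if b then ⁅ f zero ⁆ else ⊥) ∪ image (f ∘ suc) e

-- H is isomorphic to a not necessarily induced subhypergraph of G.  All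
-- vertices of H, isolated ones included, have to be placed in G.
_⊑_ : Hypergraph d m → Hypergraph d n → Set
_⊑_ {m = m} {n = n} H G =
  ∃[ f ] Injective {A = Fin m} {B = Fin n} _≡_ _≡_ f
       × All (λ e → image f e ∈ edges G) (edges H)

_-free : Hypergraph d m → Hypergraph d n → Set
(H -free) G = ¬ (H ⊑ G)

private
  ∣++∣ : (p : Subset m) (q : Subset n) → ∣ p Vec.++ q ∣ ≡ ∣ p ∣ + ∣ q ∣
  ∣++∣ []            q = refl
  ∣++∣ (inside ∷ p)  q = cong suc (∣++∣ p q)
  ∣++∣ (outside ∷ p) q = ∣++∣ p q

  ⁅⁆-injective : {i j : Fin n} → ⁅ i ⁆ ≡ ⁅ j ⁆ → i ≡ j
  ⁅⁆-injective {i = i} {j} eq =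
    x∈⁅y⁆⇒x≡y j (subst (i Data.Fin.Subset.∈_) eq (x∈⁅x⁆ i))

-- K_{H,t}: its vertex set Fin (m + t) consists of the m vertices of H
-- followed by the t new vertices.
K : Hypergraph d m → (t : ℕ) → Hypergraph (suc d) (m + t)
K {d = d} {m = m} H t = record
  { edges   = cartesianProductWith addVertex (edges H) (allFin t)
  ; unique  = Unique.cartesianProductWith⁺ addVertex
      (λ {w} {x} eq → Vec.++-injectiveˡ w x eq
                    , ⁅⁆-injective (Vec.++-injectiveʳ w x eq))
      (unique H) (Unique.allFin⁺ t)
  ; uniform = All.cartesianProductWith⁺ (setoid _) (setoid _)
      addVertex (edges H) (allFin t)
      (λ {e} {v} e∈H _ → begin
        ∣ e Vec.++ ⁅ v ⁆ ∣  ≡⟨ ∣++∣ e ⁅ v ⁆ ⟩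
        ∣ e ∣ + ∣ ⁅ v ⁆ ∣   ≡⟨ cong₂ _+_ (All.lookup (uniform H) e∈H) (∣⁅x⁆∣≡1 v) ⟩
        d + 1               ≡⟨ +-comm d 1 ⟩
        suc d               ∎)
  }
  where
  open ≡-Reasoning
  addVertex : Subset m → Fin t → Subset (m + t)
  addVertex e v = e Vec.++ ⁅ v ⁆

_≟ₛ_ : DecidableEquality (Subset n)
_≟ₛ_ = ≡-dec _≟ᵇ_

_∈?_ : (e : Subset n) (es : List (Subset n)) → Dec (e ∈ es)
e ∈? es = Any.any? (e ≟ₛ_) es

private
  image-cong : {f g : Fin m → Fin n} → (∀ i → f i ≡ g i) →
               ∀ e → image f e ≡ image g e
  image-cong f≗g []      = refl
  image-cong f≗g (b ∷ e) = cong₂ _∪_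
    (cong (λ x → if b then ⁅ x ⁆ else ⊥) (f≗g zero))
    (image-cong (f≗g ∘ suc) e)

  injective? : (f : Fin m → Fin n) → Dec (Injective _≡_ _≡_ f)
  injective? f = map′ (λ h {i} {j} → h i j) (λ h i j → h)
    (Fin.all? λ i → Fin.all? λ j → (f i Fin.≟ f j) →-dec (i Fin.≟ j))

_⊑?_ : (H : Hypergraph d m) (G : Hypergraph d n) → Dec (H ⊑ G)
_⊑?_ {m = m} {n = n} H G = map′
  (λ (k , p) → finToFun k , p)
  (λ (f , inj , sub) →
    let f≗ = λ i → finToFun-funToFin f i in
    funToFin f
    , (λ {i} {j} eq → inj (trans (sym (f≗ i)) (trans eq (f≗ j))))
    , All.map (λ {e} → subst (_∈ edges G) (sym (image-cong f≗ e))) sub)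
  (Fin.any? λ (k : Fin (n ^ m)) → let f = finToFun {n} {m} k in
     injective? f ×-dec all? (λ e → image f e ∈? edges G) (edges H))

allSubsets : ∀ n → List (Subset n)
allSubsets zero    = [] ∷ []
allSubsets (suc n) =
  map (inside ∷_) (allSubsets n) List.++ map (outside ∷_) (allSubsets n)

uniformSubsets : ∀ d n → List (Subset n)
uniformSubsets d n = filter (λ e → ∣ e ∣ ≟ d) (allSubsets n)

sublists : {A : Set} → List A → List (List A)
sublists []       = [] ∷ []
sublists (x ∷ xs) = map (x ∷_) (sublists xs) List.++ sublists xs

private
  allSubsets-complete : (e : Subset n) → e ∈ allSubsets n
  allSubsets-complete []            = here refl
  allSubsets-complete (inside ∷ e)  =
    ∈-++⁺ˡ (∈-map⁺ (inside ∷_) (allSubsets-complete e))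
  allSubsets-complete (outside ∷ e) =
    ∈-++⁺ʳ _ (∈-map⁺ (outside ∷_) (allSubsets-complete e))

  allSubsets-unique : ∀ n → Unique (allSubsets n)
  allSubsets-unique zero    = [] ∷ []
  allSubsets-unique (suc n) = Unique.++⁺
    (Unique.map⁺ Vec.∷-injectiveʳ (allSubsets-unique n))
    (Unique.map⁺ Vec.∷-injectiveʳ (allSubsets-unique n))
    λ (p , q) → disjoint (∈-map⁻ (inside ∷_) p) (∈-map⁻ (outside ∷_) q)
    where
    disjoint : {e : Subset (suc n)} →
      (∃[ x ] x ∈ allSubsets n × e ≡ inside ∷ x) →
      ¬ (∃[ y ] y ∈ allSubsets n × e ≡ outside ∷ y)
    disjoint (_ , _ , refl) (_ , _ , ())

withEdges : ∀ d → List (Subset n) → Hypergraph d n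
withEdges {n = n} d es = record
  { edges   = filter (_∈? es) (uniformSubsets d n)
  ; unique  = Unique.filter⁺ (_∈? es)
                (Unique.filter⁺ (λ e → ∣ e ∣ ≟ d) (allSubsets-unique n))
  ; uniform = All.filter⁺ (_∈? es) (all-filter (λ e → ∣ e ∣ ≟ d) (allSubsets n))
  }

-- Every d-uniform hypergraph on Fin n, up to the order of its edges.
hypergraphs : ∀ d n → List (Hypergraph d n)
hypergraphs d n = map (withEdges d) (sublists (uniformSubsets d n))

-- ex_d(n, H), which is also set to 0 in the degenerate case that there is no
-- H-free hypergraph at all (this needs H to be edgeless); ex-isMaximum below
-- characterises it.
ex : ℕ → Hypergraph d m → ℕ
ex {d = d} n H =
  max 0 (map size (filter (λ G → ¬? (H ⊑? G)) (hypergraphs d n)))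

private
  filter∈sublists : {A : Set} {P : A → Set} (P? : ∀ x → Dec (P x)) (xs : List A) →
                    filter P? xs ∈ sublists xs
  filter∈sublists P? []       = here refl
  filter∈sublists P? (x ∷ xs) with P? x
  ... | yes _ = ∈-++⁺ˡ (∈-map⁺ (x ∷_) (filter∈sublists P? xs))
  ... | no  _ = ∈-++⁺ʳ _ (filter∈sublists P? xs)

  unique-length : {A : Set} {xs ys : List A} → Unique xs →
                  (∀ {x} → x ∈ xs → x ∈ ys) → length xs ≤ length ys
  unique-length []           _   = z≤n
  unique-length {xs = x ∷ xs} (x∉ ∷ u) sub
    with as , bs , refl ← ∈-∃++ (sub (here refl)) =
    ≤-trans (s≤s (unique-length u sub′)) (≤-reflexive (begin
      suc (length (as List.++ bs))    ≡⟨ cong suc (length-++ as) ⟩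
      suc (length as + length bs)     ≡⟨ sym (+-suc (length as) (length bs)) ⟩
      length as + suc (length bs)     ≡⟨ sym (length-++ as) ⟩
      length (as List.++ x ∷ bs)      ∎))
    where
    open ≡-Reasoning
    drop-x : ∀ as {bs y} → ¬ (x ≡ y) → y ∈ as List.++ x ∷ bs → y ∈ as List.++ bs
    drop-x []       ne (here eq) = contradiction (sym eq) ne
    drop-x []       ne (there p) = p
    drop-x (_ ∷ as) ne (here eq) = here eq
    drop-x (_ ∷ as) ne (there p) = there (drop-x as ne p)
    sub′ : ∀ {y} → y ∈ xs → y ∈ as List.++ bs
    sub′ y∈ = drop-x as (All.lookup x∉ y∈) (sub (there y∈))

  enumerated : (G : Hypergraph d n) → ∃[ G′ ] G′ ∈ hypergraphs d n
    × (∀ {e} → e ∈ edges G → e ∈ edges G′)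
    × (∀ {e} → e ∈ edges G′ → e ∈ edges G)
  enumerated {d = d} {n = n} G =
      withEdges d es
    , ∈-map⁺ (withEdges d) (filter∈sublists (_∈? edges G) (uniformSubsets d n))
    , (λ e∈ → ∈-filter⁺ (_∈? es) (unif e∈)
                (∈-filter⁺ (_∈? edges G) (unif e∈) e∈))
    , (λ e∈ → proj₂ (∈-filter⁻ (_∈? edges G) {xs = uniformSubsets d n}
                (proj₂ (∈-filter⁻ (_∈? es) {xs = uniformSubsets d n} e∈))))
    where
    es : List (Subset n)
    es = filter (_∈? edges G) (uniformSubsets d n)
    unif : ∀ {e} → e ∈ edges G → e ∈ uniformSubsets d n
    unif {e} e∈ = ∈-filter⁺ (λ e → ∣ e ∣ ≟ d) (allSubsets-complete e)
                    (All.lookup (uniform G) e∈)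

  max-attained : (xs : List ℕ) → 0 < length xs → max 0 xs ∈ xs
  max-attained (x ∷ xs) _ with argmax-sel (λ y → y) 0 (x ∷ xs)
  ... | inj₂ p  = p
  ... | inj₁ eq = here (trans eq (sym (n≤0⇒n≡0 (subst (x ≤_) eq
                    (v≤max⁺ 0 (x ∷ xs) (inj₂ (here ≤-refl)))))))

  size≤ex : (H : Hypergraph d m) (G : Hypergraph d n) → (H -free) G → size G ≤ ex n H
  size≤ex {d = d} {n = n} H G free with G′ , G′∈ , sub , sup ← enumerated G =
    v≤max⁺ 0 _ (inj₂ (Any.map (λ eq → ≤-trans (unique-length (unique G) sub)
                                        (≤-reflexive eq))
      (∈-map⁺ size (∈-filter⁺ (λ G → ¬? (H ⊑? G)) G′∈
        λ (f , inj , p) → free (f , inj , All.map sup p)))))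

-- The hypothesis on G only says that some H-free hypergraph exists; if H has
-- an edge, the edgeless one will do.
ex-isMaximum : (H : Hypergraph d m) (G : Hypergraph d n) → (H -free) G →
  (∃[ G′ ] (H -free) G′ × size {d} {n} G′ ≡ ex n H)
  × (∀ (G′ : Hypergraph d n) → (H -free) G′ → size G′ ≤ ex n H)
ex-isMaximum {d = d} {n = n} H G free = attained , size≤ex H
  where
  Gs : List (Hypergraph d n)
  Gs = filter (λ G → ¬? (H ⊑? G)) (hypergraphs d n)

  nonempty : ∀ {A B : Set} {x : A} {xs : List A} (f : A → B) → x ∈ xs →
             0 < length (map f xs)
  nonempty f (here _)  = s≤s z≤n
  nonempty f (there _) = s≤s z≤n

  attained : ∃[ G′ ] (H -free) G′ × size {d} {n} G′ ≡ ex n H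
  attained
    with G₀ , G₀∈ , _ , sup ← enumerated G
    with G₁ , G₁∈ , eq ← ∈-map⁻ size (max-attained (map size Gs) (nonempty size
           (∈-filter⁺ (λ G → ¬? (H ⊑? G)) G₀∈
             λ (f , inj , p) → free (f , inj , All.map sup p)))) =
    G₁ , proj₂ (∈-filter⁻ (λ G → ¬? (H ⊑? G)) {xs = hypergraphs d n} G₁∈) , sym eq

-- f(n) = o(g(n)), with ε ranging over the reciprocals 1/k of the positive
-- integers (k = 0 adds no condition).
_=o_ : (ℕ → ℕ) → (ℕ → ℕ) → Set
f =o g = ∀ k → ∃[ N ] ∀ n → N ≤ n → k * f n ≤ g n

-- x ≤ c · (a^{1/t} + b) for t ≥ 1, without real numbers: subtract c · b,
-- where a negative difference may be replaced by 0, and compare t-th powers.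
_≤_·⟨_√_+_⟩ : ℕ → ℕ → ℕ → ℕ → ℕ → Set
x ≤ c ·⟨ t √ a + b ⟩ = (x ∸ c * b) ^ t ≤ c ^ t * a

-- f(n) = O(a(n)^{1/t} + b(n)).  A real constant can be rounded up to a
-- natural number.
_=O⟨_√_+_⟩ : (ℕ → ℕ) → ℕ → (ℕ → ℕ) → (ℕ → ℕ) → Set
f =O⟨ t √ a + b ⟩ =
  ∃[ C ] ∃[ N ] ∀ n → N ≤ n → f n ≤ C ·⟨ t √ a n + b n ⟩

{-# OPTIONS --safe #-}

-- For a d-set S let deg S be the number of vertices v ∉ S with S ∪ {v} ∈ G.
-- Count the pairs of a d-set S and a sequence φ of t distinct vertices that all
-- extend S to an edge of G.  A fixed S lies in at least (deg S ∸ t)^t of them.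
-- For a fixed φ the sets S form an H-free hypergraph, as H together with φ would
-- be a copy of K_{H,t}; so there are at most n^t · ex_d(n,H) pairs.  Hence, by
-- the power mean inequality over the at most n^d sets S,
--   (e(G) ∸ t n^d)^t ≤ (Σ_S (deg S ∸ t))^t ≤ n^{d(t-1)} · n^t · ex_d(n,H).
module Submission where

open import Defs
open import Data.Nat.Base using (ℕ; suc; _+_; _*_; _∸_; _^_; _≤_)
open import Data.Nat.Base using (zero; _<_; z≤n; s≤s)
open import Data.Bool.Base using (true; false)
open import Data.Fin.Base using (Fin; zero; suc; _↑ˡ_; _↑ʳ_; splitAt; join)
open import Data.Fin.Properties as Fin using ()
open import Data.Fin.Subset as Subset
  using (Subset; inside; outside; ∣_∣; ⁅_⁆; ⊥; _∪_)
open import Data.Fin.Subset.Properties as Subset using ()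
open import Data.List.Base as List
  using (List; []; _∷_; _++_; length; map; filter; allFin; concatMap; lookup; deduplicate; tabulate)
open import Data.List.Membership.Propositional using (_∈_; _∉_; lose)
open import Data.List.Membership.Propositional.Properties
  using ( ∈-map⁺; ∈-map⁻; ∈-++⁺ˡ; ∈-++⁺ʳ; ∈-filter⁺; ∈-filter⁻; ∈-lookup; ∈-allFin
        ; ∈-tabulate⁺; ∈-concatMap⁺; ∈-deduplicate⁺)
open import Data.List.Properties
  using ( length-++; length-map; length-tabulate; length-filter; filter-++
        ; ∷-injectiveˡ; map-id; map-cong; map-∘)
open import Data.List.Relation.Unary.All as All using (All; []; _∷_; all?)
open import Data.List.Relation.Unary.All.Properties as All
  using (all-filter; ¬Any⇒All¬)
open import Data.List.Relation.Unary.AllPairs using ([]; _∷_)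
open import Data.List.Relation.Unary.Any as Any using (here; there)
open import Data.List.Relation.Unary.Any.Properties using (lookup-index)
open import Data.List.Relation.Unary.Unique.DecPropositional.Properties using (deduplicate-!)
open import Data.List.Relation.Unary.Unique.Propositional using (Unique)
open import Data.List.Relation.Unary.Unique.Propositional.Properties as Unique
  using ()
open import Data.Nat.ListAction using (sum)
open import Data.Nat.Properties
open import Data.Nat.Tactic.RingSolver using (solve-∀)
open import Data.Product.Base using (∃-syntax; _×_; _,_; proj₁; proj₂)
open import Data.Sum.Base using (_⊎_; inj₁; inj₂; [_,_]′)
open import Data.Vec.Base as Vec using ([]; _∷_; here; there)
open import Function.Base using (_∘_; id)
open import Function.Definitions using (Injective)
open import Level using (0ℓ)
open import Relation.Binary.PropositionalEquality
open import Relation.Nullary using (¬_; Dec; yes; no; does; contradiction)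
open import Relation.Nullary.Decidable using (_×-dec_; ¬?; decidable-stable)
open import Relation.Unary using (Pred; Decidable)

private
  variable
    A B : Set
    d k m n : ℕ

-- Sums over lists and double counting.

∑ : (A → ℕ) → List A → ℕ
∑ f xs = sum (map f xs)

∑-mono : {f g : A → ℕ} (xs : List A) → (∀ {x} → x ∈ xs → f x ≤ g x) → ∑ f xs ≤ ∑ g xs
∑-mono []       f≤g = z≤n
∑-mono (x ∷ xs) f≤g = +-mono-≤ (f≤g (here refl)) (∑-mono xs (f≤g ∘ there))

∑≤length* : {f : A → ℕ} (xs : List A) {c : ℕ} → (∀ {x} → x ∈ xs → f x ≤ c) →
            ∑ f xs ≤ length xs * c
∑≤length* []       f≤c = z≤n
∑≤length* (x ∷ xs) f≤c = +-mono-≤ (f≤c (here refl)) (∑≤length* xs (f≤c ∘ there))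

∑≤*length+∑∸ : (f : A → ℕ) (c : ℕ) (xs : List A) →
                ∑ f xs ≤ c * length xs + ∑ (λ x → f x ∸ c) xs
∑≤*length+∑∸ f c []       = z≤n
∑≤*length+∑∸ f c (x ∷ xs) = begin
  f x + ∑ f xs                             ≤⟨ +-mono-≤ (m≤n+m∸n (f x) c) (∑≤*length+∑∸ f c xs) ⟩
  (c + (f x ∸ c)) + (c * length xs + r)    ≡⟨ rearrange c (f x ∸ c) (length xs) r ⟩
  c * suc (length xs) + ((f x ∸ c) + r)    ∎
  where
  open ≤-Reasoning
  r = ∑ (λ x → f x ∸ c) xs
  rearrange : ∀ c a l r → (c + a) + (c * l + r) ≡ c * suc l + (a + r)
  rearrange = solve-∀

length-concatMap : (f : A → List B) (xs : List A) →
                   length (concatMap f xs) ≡ ∑ (length ∘ f) xs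
length-concatMap f []       = refl
length-concatMap f (x ∷ xs) =
  trans (length-++ (f x)) (cong (length (f x) +_) (length-concatMap f xs))

-- The incidence matrix of `R` is summed by rows and by columns. Induction on `xs` peels off one
-- row, and `add-row` distributes its entries over the column counts.
double-count : {R : A → B → Set} (R? : ∀ x y → Dec (R x y)) (xs : List A) (ys : List B) →
  ∑ (λ x → length (filter (R? x) ys)) xs ≡ ∑ (λ y → length (filter (λ x → R? x y) xs)) ys
double-count R? []       []       = refl
double-count R? []       (y ∷ ys) = double-count R? [] ys
double-count R? (x ∷ xs) ys       =
  trans (cong (length (filter (R? x) ys) +_) (double-count R? xs ys)) (add-row ys)
  where
  swap : ∀ a b c → a + (b + c) ≡ b + (a + c)
  swap = solve-∀
  row : List _ → ℕ
  row ys = length (filter (R? x) ys)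
  column : _ → ℕ
  column y = length (filter (λ x → R? x y) xs)
  add-row : ∀ ys → row ys + ∑ column ys ≡ ∑ (λ y → length (filter (λ x → R? x y) (x ∷ xs))) ys
  add-row []       = refl
  add-row (y ∷ ys) with ih ← add-row ys | does (R? x y)
  ... | true  = cong suc (trans (swap (row ys) (column y) (∑ column ys)) (cong (column y +_) ih))
  ... | false = trans (swap (row ys) (column y) (∑ column ys)) (cong (column y +_) ih)

-- The power mean inequality.

-- The right side minus the left is `(b - a) (b ^ k - a ^ k)`, whose factors have the same sign. To
-- stay within the naturals, the case `a ≤ b` writes `b` as `a + c` and `b ^ k` as `a ^ k + C`, so
-- that the gap is `c * C`; the other case follows by symmetry.
rearrangement : ∀ k a b → a * b ^ k + a ^ k * b ≤ a ^ suc k + b ^ suc k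
rearrangement k a b = [ ordered , flipped ]′ (≤-total a b)
  where
  open ≤-Reasoning
  expand : ∀ a c A C → a * A + (a + c) * (A + C) ≡ (a * (A + C) + A * (a + c)) + c * C
  expand = solve-∀
  flip : ∀ a b A B → a * B + A * b ≡ b * A + B * a
  flip = solve-∀
  ordered : ∀ {a b} → a ≤ b → a * b ^ k + a ^ k * b ≤ a ^ suc k + b ^ suc k
  ordered {a} {b} a≤b
    with c , refl ← m≤n⇒∃[o]m+o≡n a≤b
    with C , eq ← m≤n⇒∃[o]m+o≡n (^-monoˡ-≤ k a≤b) rewrite sym eq =
    ≤-trans (m≤m+n _ (c * C)) (≤-reflexive (sym (expand a c (a ^ k) C)))
  flipped : b ≤ a → a * b ^ k + a ^ k * b ≤ a ^ suc k + b ^ suc k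
  flipped b≤a = begin
    a * b ^ k + a ^ k * b   ≡⟨ flip a b (a ^ k) (b ^ k) ⟩
    b * a ^ k + b ^ k * a   ≤⟨ ordered b≤a ⟩
    b ^ suc k + a ^ suc k   ≡⟨ +-comm (b ^ suc k) _ ⟩
    a ^ suc k + b ^ suc k   ∎

-- Chebyshev's sum inequality for the similarly ordered sequences of the entries and of their `k`-th
-- powers. When `a` joins the list, the new mixed products pair `a` with each older entry, and
-- `cross` bounds them by summing `rearrangement`.
chebyshev : ∀ k as → sum as * ∑ (_^ k) as ≤ length as * ∑ (_^ suc k) as
chebyshev k []       = z≤n
chebyshev k (a ∷ as) = begin
  (a + s) * (a ^ k + p)                        ≡⟨ expand a (a ^ k) s p ⟩
  a ^ suc k + (a * p + a ^ k * s) + s * p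
    ≤⟨ +-mono-≤ (+-monoʳ-≤ (a ^ suc k) (cross as)) (chebyshev k as) ⟩
  a ^ suc k + (l * a ^ suc k + q) + l * q      ≡⟨ collect (a ^ suc k) l q ⟩
  suc l * (a ^ suc k + q)                      ∎
  where
  open ≤-Reasoning
  s = sum as
  p = ∑ (_^ k) as
  q = ∑ (_^ suc k) as
  l = length as
  expand : ∀ a A s p → (a + s) * (A + p) ≡ a * A + (a * p + A * s) + s * p
  expand = solve-∀
  collect : ∀ b l q → b + (l * b + q) + l * q ≡ suc l * (b + q)
  collect = solve-∀
  distribute : ∀ a A b B p s → a * (B + p) + A * (b + s) ≡ (a * B + A * b) + (a * p + A * s)
  distribute = solve-∀
  gather : ∀ x y l q → (x + y) + (l * x + q) ≡ suc l * x + (y + q)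
  gather = solve-∀
  cross : ∀ bs → a * ∑ (_^ k) bs + a ^ k * sum bs ≤ length bs * a ^ suc k + ∑ (_^ suc k) bs
  cross []       = ≤-reflexive (cong₂ _+_ (*-zeroʳ a) (*-zeroʳ (a ^ k)))
  cross (b ∷ bs) = begin
    a * (b ^ k + ∑ (_^ k) bs) + a ^ k * (b + sum bs)
      ≡⟨ distribute a (a ^ k) b (b ^ k) _ _ ⟩
    (a * b ^ k + a ^ k * b) + (a * ∑ (_^ k) bs + a ^ k * sum bs)
      ≤⟨ +-mono-≤ (rearrangement k a b) (cross bs) ⟩
    (a ^ suc k + b ^ suc k) + (length bs * a ^ suc k + ∑ (_^ suc k) bs)
      ≡⟨ gather (a ^ suc k) (b ^ suc k) (length bs) _ ⟩
    length (b ∷ bs) * a ^ suc k + ∑ (_^ suc k) (b ∷ bs) ∎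

-- Induction on the exponent: multiplying by one more factor `sum as` raises the power inside the
-- sum by one and costs a factor `length as`, by `chebyshev`.
power-mean : ∀ k as → sum as ^ suc k ≤ length as ^ k * ∑ (_^ suc k) as
power-mean zero as = ≤-reflexive (begin
  sum as * 1        ≡⟨ *-identityʳ (sum as) ⟩
  sum as            ≡⟨ cong sum (map-id as) ⟨
  ∑ id as           ≡⟨ cong sum (map-cong (sym ∘ *-identityʳ) as) ⟩
  ∑ (_^ 1) as       ≡⟨ *-identityˡ _ ⟨
  1 * ∑ (_^ 1) as   ∎)
  where open ≡-Reasoning
power-mean (suc k) as = begin
  s * s ^ suc k                        ≤⟨ *-monoʳ-≤ s (power-mean k as) ⟩
  s * (l ^ k * ∑ (_^ suc k) as)        ≡⟨ swap s (l ^ k) _ ⟩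
  l ^ k * (s * ∑ (_^ suc k) as)        ≤⟨ *-monoʳ-≤ (l ^ k) (chebyshev (suc k) as) ⟩
  l ^ k * (l * ∑ (_^ suc (suc k)) as)  ≡⟨ assoc (l ^ k) l _ ⟩
  l ^ suc k * ∑ (_^ suc (suc k)) as    ∎
  where
  open ≤-Reasoning
  s = sum as
  l = length as
  swap : ∀ x y z → x * (y * z) ≡ y * (x * z)
  swap = solve-∀
  assoc : ∀ x y z → x * (y * z) ≡ y * x * z
  assoc = solve-∀

-- Pigeonhole and relocation of vertices.

lookup-injective : {xs : List A} → Unique xs → Injective _≡_ _≡_ (lookup xs)
lookup-injective (x∉ ∷ u) {zero}  {zero}  eq = refl
lookup-injective (x∉ ∷ u) {zero}  {suc j} eq = contradiction eq (All.lookup x∉ (∈-lookup j))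
lookup-injective (x∉ ∷ u) {suc i} {zero}  eq = contradiction (sym eq) (All.lookup x∉ (∈-lookup i))
lookup-injective (x∉ ∷ u) {suc i} {suc j} eq = cong suc (lookup-injective u eq)

-- Sending an index of `xs` to the position of its entry in `ys` is an injection between the index
-- sets, because `xs` has no repetitions.
unique-⊆⇒length≤ : {xs ys : List A} → Unique xs → (∀ {x} → x ∈ xs → x ∈ ys) →
                   length xs ≤ length ys
unique-⊆⇒length≤ {xs = xs} {ys} u sub = Fin.injective⇒≤ {f = λ i → Any.index (p i)} λ {i} {j} eq →
  lookup-injective u (trans (lookup-index (p i))
    (trans (cong (lookup ys) eq) (sym (lookup-index (p j)))))
  where
  p : ∀ i → lookup xs i ∈ ys
  p i = sub (∈-lookup i)

_∈ᶠ?_ : (v : Fin n) (vs : List (Fin n)) → Dec (v ∈ vs)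
v ∈ᶠ? vs = Any.any? (v Fin.≟_) vs

length-allFin : ∀ n → length (allFin n) ≡ n
length-allFin n = length-tabulate {n = n} id

fresh : (vs : List (Fin n)) → length vs < n → ∃[ v ] v ∉ vs
fresh {n = n} vs l<n with Fin.any? (λ v → ¬? (v ∈ᶠ? vs))
... | yes found = found
... | no  none  = contradiction (≤-trans (≤-reflexive (sym (length-allFin n)))
  (unique-⊆⇒length≤ (Unique.allFin⁺ n) λ {v} _ → decidable-stable (v ∈ᶠ? vs) λ v∉ → none (v , v∉)))
  (<⇒≱ l<n)

-- Makes an injection avoid `vs` while moving only the points that it sends into `vs`;
-- `length vs + m ≤ n` guarantees enough room. In the recursion a value that stays is reserved by
-- adding it to `vs`, whereas a value that moves is chosen after all the others.
relocate : (vs : List (Fin n)) (f : Fin m → Fin n) → Injective _≡_ _≡_ f → length vs + m ≤ n →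
  ∃[ g ] Injective _≡_ _≡_ g × (∀ i → g i ∉ vs) × (∀ i → f i ∉ vs → g i ≡ f i)
relocate {m = zero}          vs f inj le = f , inj , (λ ()) , (λ ())
relocate {n = n} {m = suc m} vs f inj le with f zero ∈ᶠ? vs
... | no f0∉ with g , g-inj , g∉ , g≗ ← relocate (f zero ∷ vs) (f ∘ suc) (Fin.suc-injective ∘ inj)
                                          (≤-trans (≤-reflexive (sym (+-suc (length vs) m))) le) =
    h , h-inj , h∉ , h≗
  where
  h : Fin (suc m) → Fin n
  h zero    = f zero
  h (suc i) = g i
  h-inj : Injective _≡_ _≡_ h
  h-inj {zero}  {zero}  eq = refl
  h-inj {zero}  {suc j} eq = contradiction (here (sym eq)) (g∉ j)
  h-inj {suc i} {zero}  eq = contradiction (here eq) (g∉ i)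
  h-inj {suc i} {suc j} eq = cong suc (g-inj eq)
  h∉ : ∀ i → h i ∉ vs
  h∉ zero    = f0∉
  h∉ (suc i) = g∉ i ∘ there
  h≗ : ∀ i → f i ∉ vs → h i ≡ f i
  h≗ zero    _  = refl
  -- Reserving `f zero` displaces no later value, since `f` is injective.
  h≗ (suc i) f∉ = g≗ i λ where
    (here eq)  → contradiction (inj eq) λ ()
    (there ∈vs) → f∉ ∈vs
... | yes f0∈ with g , g-inj , g∉ , g≗ ← relocate vs (f ∘ suc) (Fin.suc-injective ∘ inj)
                                           (≤-trans (+-monoʳ-≤ (length vs) (n≤1+n m)) le)
              -- The new vertex must avoid both `vs` and the `m` values of `g`, which is at most
              -- `n - 1` vertices.
              with v , v∉ ← fresh (vs ++ tabulate g) (≤-trans (s≤s (≤-reflexive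
                     (trans (length-++ vs) (cong (length vs +_) (length-tabulate g)))))
                     (≤-trans (≤-reflexive (sym (+-suc (length vs) m))) le)) =
    h , h-inj , h∉ , h≗
  where
  h : Fin (suc m) → Fin n
  h zero    = v
  h (suc i) = g i
  v≢g : ∀ i → v ≢ g i
  v≢g i refl = v∉ (∈-++⁺ʳ vs (∈-tabulate⁺ i))
  h-inj : Injective _≡_ _≡_ h
  h-inj {zero}  {zero}  eq = refl
  h-inj {zero}  {suc j} eq = contradiction eq (v≢g j)
  h-inj {suc i} {zero}  eq = contradiction (sym eq) (v≢g i)
  h-inj {suc i} {suc j} eq = cong suc (g-inj eq)
  h∉ : ∀ i → h i ∉ vs
  h∉ zero    = v∉ ∘ ∈-++⁺ˡ
  h∉ (suc i) = g∉ i
  h≗ : ∀ i → f i ∉ vs → h i ≡ f i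
  h≗ zero    f∉ = contradiction f0∈ f∉
  h≗ (suc i) f∉ = g≗ i f∉

-- Counting sequences of distinct vertices.

extensions : List (Fin n) → List (Fin n) → List (List (Fin n))
extensions vs φ = map (_∷ φ) (filter (λ v → ¬? (v ∈ᶠ? φ)) vs)

-- Ordered sequences are used rather than sets so that their number compares directly with powers,
-- without factorials.
arrangements : ℕ → List (Fin n) → List (List (Fin n))
arrangements zero    vs = [] ∷ []
arrangements (suc k) vs = concatMap (extensions vs) (arrangements k vs)

arrangements-unique : ∀ k (vs : List (Fin n)) →
                      All (λ φ → Unique φ × length φ ≡ k) (arrangements k vs)
arrangements-unique zero    vs = ([] , refl) ∷ []
arrangements-unique (suc k) vs = All.concat⁺ (All.map⁺ (All.map extend (arrangements-unique k vs)))
  where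
  extend : ∀ {φ} → Unique φ × length φ ≡ k →
           All (λ ψ → Unique ψ × length ψ ≡ suc k) (extensions vs φ)
  extend {φ} (u , l) = All.map⁺ (All.map (λ v∉ → (¬Any⇒All¬ φ v∉ ∷ u) , cong suc l)
                                         (all-filter (λ v → ¬? (v ∈ᶠ? φ)) vs))

length-arrangements : ∀ k (vs : List (Fin n)) → length (arrangements k vs) ≤ length vs ^ k
length-arrangements zero    vs = ≤-refl
length-arrangements (suc k) vs = begin
  length (concatMap (extensions vs) φs)   ≡⟨ length-concatMap (extensions vs) φs ⟩
  ∑ (length ∘ extensions vs) φs           ≤⟨ ∑≤length* φs (λ {φ} _ → length-extensions φ) ⟩
  length φs * length vs                   ≤⟨ *-monoˡ-≤ (length vs) (length-arrangements k vs) ⟩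
  length vs ^ k * length vs               ≡⟨ *-comm (length vs ^ k) _ ⟩
  length vs ^ suc k                       ∎
  where
  open ≤-Reasoning
  φs = arrangements k vs
  length-extensions : ∀ φ → length (extensions vs φ) ≤ length vs
  length-extensions φ = ≤-trans (≤-reflexive (length-map (_∷ φ) (filter _ vs)))
                                (length-filter _ vs)

module _ {P : Pred (Fin n) 0ℓ} (P? : Decidable P) {vs : List (Fin n)} (vs! : Unique vs) where

  private
    D = length (filter P? vs)

  -- Of the `D` vertices satisfying `P`, at most `length φ` already occur in `φ`; each of the others
  -- can be put in front of it.
  count-extensions : ∀ {φ} → All P φ → D ∸ length φ ≤ length (filter (all? P?) (extensions vs φ))
  count-extensions {φ} Pφ = m≤n+o⇒m∸n≤o D (length φ) (begin
    D                                        ≡⟨ length-map (_∷ φ) (filter P? vs) ⟨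
    length (map (_∷ φ) (filter P? vs))
      ≤⟨ unique-⊆⇒length≤ (Unique.map⁺ ∷-injectiveˡ (Unique.filter⁺ P? vs!)) split ⟩
    length (map (_∷ φ) φ ++ new)             ≡⟨ length-++ (map (_∷ φ) φ) ⟩
    length (map (_∷ φ) φ) + length new       ≡⟨ cong (_+ length new) (length-map (_∷ φ) φ) ⟩
    length φ + length new                    ∎)
    where
    open ≤-Reasoning
    new = filter (all? P?) (extensions vs φ)
    split : ∀ {ψ} → ψ ∈ map (_∷ φ) (filter P? vs) → ψ ∈ map (_∷ φ) φ ++ new
    split ψ∈ with v , v∈ , refl ← ∈-map⁻ (_∷ φ) ψ∈
             with v∈vs , Pv ← ∈-filter⁻ P? {xs = vs} v∈
             with v ∈ᶠ? φ
    ... | yes v∈φ = ∈-++⁺ˡ (∈-map⁺ (_∷ φ) v∈φ)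
    ... | no  v∉φ = ∈-++⁺ʳ _ (∈-filter⁺ (all? P?)
                      (∈-map⁺ (_∷ φ) (∈-filter⁺ (λ v → ¬? (v ∈ᶠ? φ)) v∈vs v∉φ)) (Pv ∷ Pφ))

  count-concatMap-extensions : ∀ {φs} → All (λ φ → length φ ≡ k) φs →
    (D ∸ k) * length (filter (all? P?) φs) ≤ length (filter (all? P?) (concatMap (extensions vs) φs))
  count-concatMap-extensions {k = k} []                = ≤-reflexive (*-zeroʳ (D ∸ k))
  count-concatMap-extensions {φs = φ ∷ φs} (refl ∷ ls)
    rewrite filter-++ (all? P?) (extensions vs φ) (concatMap (extensions vs) φs)
          | length-++ (filter (all? P?) (extensions vs φ))
                      {filter (all? P?) (concatMap (extensions vs) φs)}
    with all? P? φ
  ... | yes Pφ = ≤-trans (≤-reflexive (*-suc (D ∸ length φ) _))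
                         (+-mono-≤ (count-extensions Pφ) (count-concatMap-extensions ls))
  ... | no  _  = ≤-trans (count-concatMap-extensions ls) (m≤n+m _ _)

  -- The sequences counted number `D (D - 1) ... (D - k + 1)`, a product of `k` factors each at
  -- least `D ∸ k`. The induction gains the factor `D ∸ k` when passing from length `k` to `suc k`.
  count-arrangements : ∀ k → (D ∸ k) ^ k ≤ length (filter (all? P?) (arrangements k vs))
  count-arrangements zero    = ≤-refl
  count-arrangements (suc k) = begin
    (D ∸ suc k) ^ suc k
      ≤⟨ ^-monoˡ-≤ (suc k) (∸-monoʳ-≤ D (n≤1+n k)) ⟩
    (D ∸ k) * (D ∸ k) ^ k
      ≤⟨ *-monoʳ-≤ (D ∸ k) (count-arrangements k) ⟩
    (D ∸ k) * length (filter (all? P?) (arrangements k vs))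
      ≤⟨ count-concatMap-extensions (All.map proj₂ (arrangements-unique k vs)) ⟩
    length (filter (all? P?) (arrangements (suc k) vs))       ∎
    where open ≤-Reasoning

-- Enumerating the sets of size `d`.

remove-vertex : (e : Subset n) → ∣ e ∣ ≡ suc d →
                ∃[ S ] ∃[ v ] ∣ S ∣ ≡ d × v Subset.∉ S × S ∪ ⁅ v ⁆ ≡ e
remove-vertex (inside ∷ e)  eq =
  outside ∷ e , zero , suc-injective eq , (λ ()) , cong (inside ∷_) (Subset.∪-identityʳ e)
remove-vertex (outside ∷ e) eq with S , v , ∣S∣ , v∉ , refl ← remove-vertex e eq =
  outside ∷ S , suc v , ∣S∣ , (λ where (there v∈) → v∉ v∈) , refl

∣p∣≡0⇒p≡⊥ : (p : Subset n) → ∣ p ∣ ≡ 0 → p ≡ ⊥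
∣p∣≡0⇒p≡⊥ []            eq = refl
∣p∣≡0⇒p≡⊥ (outside ∷ p) eq = cong (outside ∷_) (∣p∣≡0⇒p≡⊥ p eq)

fromList : List (Fin n) → Subset n
fromList []      = ⊥
fromList (v ∷ φ) = fromList φ ∪ ⁅ v ⁆

∈-fromList⁺ : ∀ {v} {φ : List (Fin n)} → v ∈ φ → v Subset.∈ fromList φ
∈-fromList⁺ {φ = w ∷ φ} (here refl) = Subset.q⊆p∪q (fromList φ) _ (Subset.x∈⁅x⁆ w)
∈-fromList⁺ {φ = w ∷ φ} (there v∈)  = Subset.p⊆p∪q _ (∈-fromList⁺ v∈)

-- Transfers the bound on the number of sequences to sets. Removing a vertex `v` leaves a set listed
-- by some `φ`; as `v` lies outside that set, it does not occur in `φ` and extends it.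
arranged : ∀ d (e : Subset n) → ∣ e ∣ ≡ d → e ∈ map fromList (arrangements d (allFin n))
arranged zero    e eq = here (∣p∣≡0⇒p≡⊥ e eq)
arranged (suc d) e eq
  with S , v , ∣S∣ , v∉S , refl ← remove-vertex e eq
  with φ , φ∈ , refl ← ∈-map⁻ fromList (arranged d S ∣S∣) =
  ∈-map⁺ fromList (∈-concatMap⁺ (extensions (allFin _)) (lose φ∈
    (∈-map⁺ (_∷ φ) (∈-filter⁺ (λ v → ¬? (v ∈ᶠ? φ)) (∈-allFin v) (v∉S ∘ ∈-fromList⁺)))))

size≤n^d : (G : Hypergraph d n) → size G ≤ n ^ d
size≤n^d {d = d} {n = n} G = begin
  size G
    ≤⟨ unique-⊆⇒length≤ (unique G) (λ {e} e∈ → arranged d e (All.lookup (uniform G) e∈)) ⟩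
  length (map fromList (arrangements d (allFin n)))
    ≡⟨ length-map fromList (arrangements d (allFin n)) ⟩
  length (arrangements d (allFin n))               ≤⟨ length-arrangements d (allFin n) ⟩
  length (allFin n) ^ d                            ≡⟨ cong (_^ d) (length-allFin n) ⟩
  n ^ d                                            ∎
  where open ≤-Reasoning

-- Each set arises from every ordering of its elements, hence `deduplicate`.
complete : ∀ d n → Hypergraph d n
complete d n = record
  { edges   = filter (λ e → ∣ e ∣ ≟ d) (deduplicate _≟ₛ_ es)
  ; unique  = Unique.filter⁺ (λ e → ∣ e ∣ ≟ d) (deduplicate-! _≟ₛ_ es)
  ; uniform = all-filter (λ e → ∣ e ∣ ≟ d) (deduplicate _≟ₛ_ es)
  }
  where
  es = map fromList (arrangements d (allFin n))

complete-∈ : (e : Subset n) → ∣ e ∣ ≡ d → e ∈ edges (complete d n)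
complete-∈ {d = d} e eq = ∈-filter⁺ (λ e → ∣ e ∣ ≟ d) (∈-deduplicate⁺ _≟ₛ_ (arranged d e eq)) eq

restrict : {P : Pred (Subset n) 0ℓ} → Decidable P → Hypergraph d n → Hypergraph d n
restrict P? G = record
  { edges   = filter P? (edges G)
  ; unique  = Unique.filter⁺ P? (unique G)
  ; uniform = All.filter⁺ P? (uniform G)
  }

-- Images of edges under vertex maps.

image-⊥ : (f : Fin m → Fin n) → image f ⊥ ≡ ⊥
image-⊥ {m = zero}  f = refl
image-⊥ {m = suc m} f = trans (Subset.∪-identityˡ _) (image-⊥ (f ∘ suc))

image-⁅⁆ : (f : Fin m → Fin n) (v : Fin m) → image f ⁅ v ⁆ ≡ ⁅ f v ⁆
image-⁅⁆ f zero    = trans (cong (⁅ f zero ⁆ ∪_) (image-⊥ (f ∘ suc))) (Subset.∪-identityʳ _)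
image-⁅⁆ f (suc v) = trans (Subset.∪-identityˡ _) (image-⁅⁆ (f ∘ suc) v)

image-++ : (f : Fin (m + k) → Fin n) (p : Subset m) (q : Subset k) →
           image f (p Vec.++ q) ≡ image (f ∘ (_↑ˡ k)) p ∪ image (f ∘ (m ↑ʳ_)) q
image-++ f []      q = sym (Subset.∪-identityˡ _)
image-++ f (b ∷ p) q = trans (cong (_ ∪_) (image-++ (f ∘ suc) p q)) (sym (Subset.∪-assoc _ _ _))

image-cong : {f g : Fin m → Fin n} (e : Subset m) → (∀ {i} → i Subset.∈ e → f i ≡ g i) →
             image f e ≡ image g e
image-cong []            f≗g = refl
image-cong (inside ∷ e)  f≗g = cong₂ _∪_ (cong ⁅_⁆ (f≗g here)) (image-cong e (f≗g ∘ there))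
image-cong (outside ∷ e) f≗g = cong (⊥ ∪_) (image-cong e (f≗g ∘ there))

∈-image⁺ : (f : Fin m → Fin n) {i : Fin m} {e : Subset m} → i Subset.∈ e → f i Subset.∈ image f e
∈-image⁺ f {zero}                here       = Subset.p⊆p∪q _ (Subset.x∈⁅x⁆ (f zero))
∈-image⁺ f {suc i} {e = b ∷ e}   (there i∈) = Subset.q⊆p∪q _ _ (∈-image⁺ (f ∘ suc) i∈)

-- Degrees and common links.

-- The first component lets `commonLink-free` read off that a sequence extending `S` is disjoint
-- from `S`.
Extends : Hypergraph (suc d) n → Subset n → Fin n → Set
Extends G S v = v Subset.∉ S × S ∪ ⁅ v ⁆ ∈ edges G

extends? : (G : Hypergraph (suc d) n) (S : Subset n) → Decidable (Extends G S)
extends? G S v = ¬? (v Subset.∈? S) ×-dec ((S ∪ ⁅ v ⁆) ∈? edges G)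

degree : Hypergraph (suc d) n → Subset n → ℕ
degree {n = n} G S = length (filter (extends? G S) (allFin n))

-- Every edge lies in the cone over any of its subsets of size `d`. There are `suc d` of these, but
-- one is enough for an upper bound.
size≤∑degree : (G : Hypergraph (suc d) n) → size G ≤ ∑ (degree G) (edges (complete d n))
size≤∑degree {d = d} {n = n} G = begin
  size G                           ≤⟨ unique-⊆⇒length≤ (unique G) covered ⟩
  length (concatMap cone Ss)       ≡⟨ length-concatMap cone Ss ⟩
  ∑ (length ∘ cone) Ss
    ≤⟨ ∑-mono Ss (λ {S} _ → ≤-reflexive (length-map (λ v → S ∪ ⁅ v ⁆) (filter (extends? G S) (allFin n)))) ⟩
  ∑ (degree G) Ss                  ∎
  where
  open ≤-Reasoning
  Ss = edges (complete d n)
  cone : Subset n → List (Subset n)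
  cone S = map (λ v → S ∪ ⁅ v ⁆) (filter (extends? G S) (allFin n))
  covered : ∀ {e} → e ∈ edges G → e ∈ concatMap cone Ss
  covered {e} e∈ with S , v , ∣S∣ , v∉S , refl ← remove-vertex e (All.lookup (uniform G) e∈) =
    ∈-concatMap⁺ cone (lose (complete-∈ S ∣S∣)
      (∈-map⁺ (λ v → S ∪ ⁅ v ⁆) (∈-filter⁺ (extends? G S) (∈-allFin v) (v∉S , e∈))))

commonLink : Hypergraph (suc d) n → List (Fin n) → Hypergraph d n
commonLink G φ = restrict (λ S → all? (extends? G S) φ) (complete _ _)

-- Isolated vertices of H may have been placed on φ and have to be relocated.
commonLink-free : (H : Hypergraph d m) (G : Hypergraph (suc d) n) {φ : List (Fin n)} → Unique φ →
  length φ + m ≤ n → (K H (length φ) -free) G → (H -free) (commonLink G φ)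
commonLink-free {d = d} {m = m} {n = n} H G {φ} φ! le free (f , f-inj , sub)
  with f′ , f′-inj , f′∉ , f′≗ ← relocate φ f f-inj le =
  free (g , g-inj , All.cartesianProductWith⁺ (setoid _) (setoid _) _ (edges H) (allFin t)
                      λ {e} {v} e∈ _ → edge e∈ v)
  where
  t = length φ
  place : Fin m ⊎ Fin t → Fin n
  place = [ f′ , lookup φ ]′
  g : Fin (m + t) → Fin n
  g = place ∘ splitAt m
  place-inj : ∀ x y → place x ≡ place y → x ≡ y
  place-inj (inj₁ i) (inj₁ j) eq = cong inj₁ (f′-inj eq)
  place-inj (inj₁ i) (inj₂ j) eq = contradiction (subst (_∈ φ) (sym eq) (∈-lookup j)) (f′∉ i)
  place-inj (inj₂ i) (inj₁ j) eq = contradiction (subst (_∈ φ) eq (∈-lookup i)) (f′∉ j)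
  place-inj (inj₂ i) (inj₂ j) eq = cong inj₂ (lookup-injective φ! eq)
  g-inj : Injective _≡_ _≡_ g
  g-inj {i} {j} eq = trans (sym (Fin.join-splitAt m t i))
    (trans (cong (join m t) (place-inj (splitAt m i) (splitAt m j) eq)) (Fin.join-splitAt m t j))
  edge : ∀ {e} → e ∈ edges H → ∀ v → image g (e Vec.++ ⁅ v ⁆) ∈ edges G
  edge {e} e∈ v = subst (_∈ edges G) (sym image-g) (proj₂ (All.lookup ext (∈-lookup v)))
    where
    open ≡-Reasoning
    ext : All (Extends G (image f e)) φ
    ext = proj₂ (∈-filter⁻ (λ S → all? (extends? G S) φ) {xs = edges (complete d n)} (All.lookup sub e∈))
    -- The image of an edge is a set extended by every entry of `φ`, hence disjoint from `φ`; so
    -- `relocate` has left the vertices of the edge in place.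
    agree : ∀ {i} → i Subset.∈ e → g (i ↑ˡ t) ≡ f i
    agree {i} i∈ = trans (cong place (Fin.splitAt-↑ˡ m i t))
      (f′≗ i λ fi∈φ → proj₁ (All.lookup ext fi∈φ) (∈-image⁺ f i∈))
    image-g : image g (e Vec.++ ⁅ v ⁆) ≡ image f e ∪ ⁅ lookup φ v ⁆
    image-g = begin
      image g (e Vec.++ ⁅ v ⁆)                             ≡⟨ image-++ g e ⁅ v ⁆ ⟩
      image (g ∘ (_↑ˡ t)) e ∪ image (g ∘ (m ↑ʳ_)) ⁅ v ⁆
        ≡⟨ cong₂ _∪_ (image-cong e agree) (image-⁅⁆ (g ∘ (m ↑ʳ_)) v) ⟩
      image f e ∪ ⁅ g (m ↑ʳ v) ⁆
        ≡⟨ cong (λ x → image f e ∪ ⁅ place x ⁆) (Fin.splitAt-↑ʳ m t v) ⟩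
      image f e ∪ ⁅ lookup φ v ⁆                           ∎

commonLink-size : (H : Hypergraph d m) (G : Hypergraph (suc d) n) → k + m ≤ n → (K H k -free) G →
  ∀ {φ} → Unique φ × length φ ≡ k → size (commonLink G φ) ≤ ex n H
commonLink-size H G le free {φ} (φ! , refl) =
  -- The common link serves twice: as the witness that an `H`-free hypergraph exists, and as the
  -- hypergraph being bounded.
  proj₂ (ex-isMaximum H (commonLink G φ) link-free) (commonLink G φ) link-free
  where
  link-free : (H -free) (commonLink G φ)
  link-free = commonLink-free H G φ! le free

-- The counting bound for a single hypergraph.

∑[degree∸k]^k≤ : (H : Hypergraph d m) (G : Hypergraph (suc d) n) → k + m ≤ n → (K H k -free) G →
  ∑ (λ S → (degree G S ∸ k) ^ k) (edges (complete d n)) ≤ n ^ k * ex n H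
∑[degree∸k]^k≤ {d = d} {n = n} {k = k} H G le free = begin
  ∑ (λ S → (degree G S ∸ k) ^ k) Ss
    ≤⟨ ∑-mono Ss (λ {S} _ → count-arrangements (extends? G S) (Unique.allFin⁺ n) k) ⟩
  ∑ (λ S → length (filter (all? (extends? G S)) φs)) Ss
    -- For fixed `φ`, the filtered list of sets is by definition the edge list of `commonLink G φ`.
    ≡⟨ double-count (λ S → all? (extends? G S)) Ss φs ⟩
  ∑ (λ φ → size (commonLink G φ)) φs
    ≤⟨ ∑≤length* φs (λ φ∈ → commonLink-size H G le free (All.lookup (arrangements-unique k (allFin n)) φ∈)) ⟩
  length φs * ex n H
    ≤⟨ *-monoˡ-≤ (ex n H) (length-arrangements k (allFin n)) ⟩
  length (allFin n) ^ k * ex n H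
    ≡⟨ cong (λ l → l ^ k * ex n H) (length-allFin n) ⟩
  n ^ k * ex n H                                           ∎
  where
  open ≤-Reasoning
  Ss = edges (complete d n)
  φs = arrangements k (allFin n)

K-free-size : ∀ {t} (H : Hypergraph d m) (G : Hypergraph (suc d) n) → 1 ≤ t → t + m ≤ n →
  (K H t -free) G → (size G ∸ t * n ^ d) ^ t ≤ ex n H * n ^ (t * suc d ∸ d)
K-free-size {d = d} {n = n} {t = t@(suc k)} H G (s≤s _) le free = begin
  (size G ∸ t * n ^ d) ^ t
    ≤⟨ ^-monoˡ-≤ t (m≤n+o⇒m∸n≤o (size G) (t * n ^ d) size≤) ⟩
  sum excess ^ t                               ≤⟨ power-mean k excess ⟩
  length excess ^ k * ∑ (_^ t) excess
    ≡⟨ cong₂ (λ l s → l ^ k * s) (length-map _ Ss) (cong sum (sym (map-∘ Ss))) ⟩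
  length Ss ^ k * ∑ (λ S → (degree G S ∸ t) ^ t) Ss
                                               ≤⟨ *-mono-≤ (^-monoˡ-≤ k (size≤n^d (complete d n))) (∑[degree∸k]^k≤ H G le free) ⟩
  (n ^ d) ^ k * (n ^ t * ex n H)               ≡⟨ cong (_* (n ^ t * ex n H)) (^-*-assoc n d k) ⟩
  n ^ (d * k) * (n ^ t * ex n H)               ≡⟨ reorder (n ^ (d * k)) (n ^ t) (ex n H) ⟩
  ex n H * (n ^ (d * k) * n ^ t)               ≡⟨ cong (ex n H *_) (^-distribˡ-+-* n (d * k) t) ⟨
  -- With `t` equal to `suc k`, the sets contribute `d * k` to the exponent and the sequences `t`.
  -- The total is `t` times `d + 1 - d/t`, and the subtraction of `d` is exact.
  ex n H * n ^ (d * k + t)                     ≡⟨ cong (λ x → ex n H * n ^ x) exponent ⟩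
  ex n H * n ^ (t * suc d ∸ d)                 ∎
  where
  open ≤-Reasoning
  Ss = edges (complete d n)
  excess = map (λ S → degree G S ∸ t) Ss
  -- Lowering each degree by `t` loses at most `t` per set, and there are at most `n ^ d` sets; this
  -- is the source of the second term of the bound.
  size≤ : size G ≤ t * n ^ d + sum excess
  size≤ = begin
    size G                       ≤⟨ size≤∑degree G ⟩
    ∑ (degree G) Ss              ≤⟨ ∑≤*length+∑∸ (degree G) t Ss ⟩
    t * length Ss + sum excess   ≤⟨ +-monoˡ-≤ (sum excess) (*-monoʳ-≤ t (size≤n^d (complete d n))) ⟩
    t * n ^ d + sum excess       ∎
  reorder : ∀ x y z → x * (y * z) ≡ z * (x * y)
  reorder = solve-∀
  expand : ∀ d k → suc k * suc d ≡ d + (d * k + suc k)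
  expand = solve-∀
  exponent : d * k + t ≡ t * suc d ∸ d
  exponent = sym (trans (cong (_∸ d) (expand d k)) (m+n∸m≡n d (d * k + t)))

-- Extremal hypergraphs and the asymptotic bound.

edgeless : Hypergraph d n
edgeless = record { edges = [] ; unique = [] ; uniform = [] }

-- Provides the free hypergraph that `ex-isMaximum` requires before it yields one attaining the
-- maximum.
edgeless-free : (H : Hypergraph d m) → 1 ≤ size H → (H -free) (edgeless {d} {n})
edgeless-free H 1≤ (_ , _ , sub) with edges H | 1≤ | sub
... | _ ∷ _ | _ | () ∷ _

size-K : (H : Hypergraph d m) (t : ℕ) → 1 ≤ size H → 1 ≤ t → 1 ≤ size (K H t)
size-K H (suc t) 1≤ _ with edges H | 1≤
... | _ ∷ _ | _ = s≤s z≤n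

theorem2p3 : ∀ {d t m : ℕ} → 1 ≤ d → 2 ≤ t →
    (H : Hypergraph d m) → 2 ≤ size H →
    (λ n → ex n H) =o (λ n → n ^ d) →
    (λ n → ex n (K H t)) =O⟨ t √ (λ n → ex n H * n ^ (t * suc d ∸ d)) + (λ n → t * n ^ d) ⟩
-- The constant is 1. The threshold `t + m` leaves room to place the `m` vertices of `H` away from
-- the `t` entries of a sequence.
theorem2p3 {d} {t} {m} _ 2≤t H 2≤H _ = 1 , t + m , bound
  where
  1≤t = ≤-trans (n≤1+n 1) 2≤t
  bound : ∀ n → t + m ≤ n → ex n (K H t) ≤ 1 ·⟨ t √ ex n H * n ^ (t * suc d ∸ d) + t * n ^ d ⟩
  bound n le
    with G , free , eq ← proj₁ (ex-isMaximum (K H t) (edgeless {n = n})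
           (edgeless-free (K H t) (size-K H t (≤-trans (n≤1+n 1) 2≤H) 1≤t)))
    -- Replaces the extremal number by the size of the extremal `G` and clears the factors `1` and
    -- `1 ^ t` that come from the constant.
    rewrite sym eq | *-identityˡ (t * n ^ d) | ^-zeroˡ t | *-identityˡ (ex n H * n ^ (t * suc d ∸ d)) =
    K-free-size H G 1≤t le free
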